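{- Let $G$ be a finite simple undirected graph that is 2-connected. Let $p$ be the order of a longest path in $G$ and $c$ the order of a longest cycle in $G$. If $$\frac{1}{3}\sigma_3\ge \frac{p+2}{3},$$ then $c\ge p-1$.
   Context: All graphs are finite, undirected, without loops or multiple edges. The order of a path or cycle is its number of vertices. A graph is 2-connected if its vertex connectivity is at least 2 (with the connectivity of $K_n$ equal to $n-1$). Let $\alpha$ be the independence number of $G$. If $\alpha\ge 3$, $\sigma_3$ denotes the minimum of $d(x)+d(y)+d(z)$ over all independent sets $\{x,y,z\}$ of three distinct vertices of $G$; if $\alpha<3$, then $\sigma_3=+\infty$ (so the hypothesis on $\sigma_3$ holds automatically). By convention a single vertex and a single edge are regarded as cycles of orders 1 and 2, respectively. -}

module Defs where

open import Data.Fin.Base using (Fin)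
open import Data.Fin.Subset using (Subset; ⁅_⁆; _∪_; _∈_; _∉_; ∣_∣)
open import Data.List.Base using (List; []; _∷_; [_]; _∷ʳ_; length)
open import Data.List.Relation.Unary.Linked using (Linked)
open import Data.List.Relation.Unary.Unique.Propositional using (Unique)
open import Data.Nat.Base using (ℕ; _+_; _∸_; _≤_; _<_)
open import Data.Product.Base using (∃-syntax; _×_)
open import Data.Vec.Base using (tabulate)
open import Level using (0ℓ)
open import Relation.Binary.Construct.Closure.ReflexiveTransitive using (Star)
open import Relation.Binary.Core using (Rel)
open import Relation.Binary.Definitions using (Decidable; Irreflexive; Symmetric)
open import Relation.Binary.PropositionalEquality.Core using (_≡_; _≢_)
open import Relation.Nullary.Construct.Add.Supremum using (_⁺; ⊤⁺)
import Relation.Nullary.Construct.Add.Supremum as Supremum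
open import Relation.Nullary.Decidable.Core using (does)
open import Relation.Nullary.Negation.Core using (¬_)

IsMinimum : (ℕ → Set) → ℕ → Set
IsMinimum P m = P m × (∀ k → P k → m ≤ k)

IsMaximum : (ℕ → Set) → ℕ → Set
IsMaximum P m = P m × (∀ k → P k → k ≤ m)

-- Adjacency is decidable because the graph is a finite object; classically
-- this is no restriction.
record Graph (n : ℕ) : Set₁ where
  infix 4 _~_ _~?_
  field
    _~_      : Rel (Fin n) 0ℓ
    _~?_     : Decidable _~_
    ~-sym    : Symmetric _~_
    ~-irrefl : Irreflexive _≡_ _~_

module _ {n : ℕ} (G : Graph n) where
  open Graph G

  neighbourhood : Fin n → Subset n
  neighbourhood v = tabulate (λ u → does (v ~? u))

  degree : Fin n → ℕ
  degree v = ∣ neighbourhood v ∣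

  record IsPath (vs : List (Fin n)) : Set where
    field
      nonempty : vs ≢ []
      distinct : Unique vs
      linked   : Linked _~_ vs

  -- A cycle is listed without repeating its first vertex.  Single vertices and
  -- single edges count as cycles of orders 1 and 2.
  data IsCycle : List (Fin n) → Set where
    vertex : ∀ v → IsCycle [ v ]
    edge   : ∀ {u v} → u ~ v → IsCycle (u ∷ v ∷ [])
    cycle  : ∀ {v vs} → 3 ≤ length (v ∷ vs) → Unique (v ∷ vs) →
             Linked _~_ ((v ∷ vs) ∷ʳ v) → IsCycle (v ∷ vs)

  IsLongestPathOrder : ℕ → Set
  IsLongestPathOrder = IsMaximum λ k → ∃[ vs ] IsPath vs × length vs ≡ k

  IsLongestCycleOrder : ℕ → Set
  IsLongestCycleOrder = IsMaximum λ k → ∃[ vs ] IsCycle vs × length vs ≡ k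

  IsComplete : Set
  IsComplete = ∀ {u v} → u ≢ v → u ~ v

  AdjacentOutside : Subset n → Rel (Fin n) 0ℓ
  AdjacentOutside S u v = u ∉ S × v ∉ S × u ~ v

  -- Deleting S leaves a disconnected graph.
  IsSeparator : Subset n → Set
  IsSeparator S =
    ∃[ u ] ∃[ v ] u ∉ S × v ∉ S × ¬ Star (AdjacentOutside S) u v

  data IsConnectivity : ℕ → Set where
    complete    : IsComplete → IsConnectivity (n ∸ 1)
    notComplete : ∀ {κ} → ¬ IsComplete →
                  IsMinimum (λ k → ∃[ S ] IsSeparator S × ∣ S ∣ ≡ k) κ →
                  IsConnectivity κ

  TwoConnected : Set
  TwoConnected = ∃[ κ ] IsConnectivity κ × 2 ≤ κ

  IsIndependent : Subset n → Set
  IsIndependent S = ∀ {u v} → u ∈ S → v ∈ S → ¬ u ~ v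

  IsIndependenceNumber : ℕ → Set
  IsIndependenceNumber = IsMaximum λ k → ∃[ S ] IsIndependent S × ∣ S ∣ ≡ k

  IsIndependentTriple : Fin n → Fin n → Fin n → Set
  IsIndependentTriple x y z =
    x ≢ y × x ≢ z × y ≢ z × IsIndependent (⁅ x ⁆ ∪ ⁅ y ⁆ ∪ ⁅ z ⁆)

  IsTripleDegreeSum : ℕ → Set
  IsTripleDegreeSum s =
    ∃[ x ] ∃[ y ] ∃[ z ] IsIndependentTriple x y z ×
    degree x + degree y + degree z ≡ s

  data IsSigma₃ : ℕ ⁺ → Set where
    finite   : ∀ {α s} → IsIndependenceNumber α → 3 ≤ α →
               IsMinimum IsTripleDegreeSum s → IsSigma₃ Supremum.[ s ]
    infinite : ∀ {α} → IsIndependenceNumber α → α < 3 → IsSigma₃ ⊤⁺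

{-# OPTIONS --safe #-}
-- Let P be a longest path and suppose that there is no cycle of order at least
-- p − 1.  If the end x of P has a neighbour that comes after a neighbour of the
-- other end y, the graph contains a theta: a cycle C and a disjoint path S with
-- |C| + |S| = p whose ends s, t are adjacent to distinct vertices a, b of C.
-- Take one with S shortest.  With y, x the successors of a, b on C, the triple
-- {x, y, s} is independent, and rerouting C through S restricts the neighbours
-- of x, y, s on both arcs of C so that their degrees sum to at most p + 1.
--
-- Otherwise take x on a longest path v₁ … vₚ with a neighbour v_k of largest
-- possible index.  Then N(y) ⊆ {v_k, …, vₚ}, while every end of a path through
-- H = {v₁, …, v_k} finishing in v_k has all its neighbours in H.  The degree
-- condition makes every vertex of H other than v_k such an end, by an argument
-- of Ore type, so v_k is a cut vertex.
module Submission where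

open import Defs
import Algebra.Solver.CommutativeMonoid as CommutativeMonoidSolver
open import Data.Bool.Base using (true; if_then_else_)
open import Data.Empty using (⊥; ⊥-elim)
open import Data.Fin.Base using (Fin; zero; suc)
import Data.Fin.Properties as Fin
open import Data.Fin.Subset using (Subset; inside; outside; ∣_∣; _-_; ⁅_⁆; _∪_)
import Data.Fin.Subset as Subset
open import Data.Fin.Subset.Properties
  using (p─⊥≡p; p─q⊆p; Empty-unique; ∣⊥∣≡0; x∈⁅x⁆; x∈⁅y⁆⇒x≡y; x≢y⇒x∉⁅y⁆; x∉⁅y⁆⇒x≢y;
         ∣⁅x⁆∣≡1; x∈p∪q⁺; x∈p∪q⁻; x∈p∧x≢y⇒x∈p-y; x∈p⇒∣p-x∣<∣p∣)
import Data.Integer.Properties as ℤ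
open import Data.List.Base using (List; []; _∷_; _++_; _∷ʳ_; length)
import Data.List.Membership.DecPropositional as DecMembership
open import Data.List.Membership.Propositional using (_∈_)
open import Data.List.Membership.Propositional.Properties using (∈-++⁺ˡ; ∈-++⁺ʳ; ∈-++⁻)
open import Data.List.Properties using (map-++; length-++; ++-assoc; ∷-injectiveˡ; ∷-injectiveʳ)
open import Data.List.Relation.Binary.Permutation.Propositional
  using (_↭_; prep; ↭-refl; ↭-sym; ↭-trans; ↭-reflexive; ↭⇒↭ₛ)
open import Data.List.Relation.Binary.Permutation.Propositional.Properties
  using (++⁺; ++⁺ˡ; ++⁺ʳ; ++-comm; ∈-resp-↭; ↭-length; ++-commutativeMonoid)
import Data.List.Relation.Binary.Permutation.Setoid.Properties as Permutationₛ
open import Data.List.Relation.Unary.All using (lookup)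
open import Data.List.Relation.Unary.All.Properties using (¬Any⇒All¬)
open import Data.List.Relation.Unary.AllPairs using (_∷_)
open import Data.List.Relation.Unary.Any using (here; there)
open import Data.List.Relation.Unary.Any.Properties using (¬Any[])
open import Data.List.Relation.Unary.Linked using (Linked; [-]; _∷_)
open import Data.List.Relation.Unary.Unique.Propositional using (Unique)
open import Data.Nat.Base using (ℕ; zero; suc; _+_; _∸_; z≤n; s≤s)
import Data.Nat.Base as ℕ
open import Data.Nat.ListAction using (sum)
open import Data.Nat.ListAction.Properties using (sum-++)
open import Data.Nat.Properties
open import Data.Nat.Solver using (module +-*-Solver)
open import Data.Product.Base using (∃₂; ∃-syntax; _×_; _,_; proj₁; proj₂)
open import Data.Sum.Base using (_⊎_; inj₁; inj₂)
open import Data.Vec.Base using (_∷_; there)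
import Data.Vec.Base as Vec
open import Data.Vec.Properties using ([]=⇒lookup; lookup∘tabulate)
open import Function.Base using (_∘_)
open import Level using (0ℓ)
open import Relation.Binary.Construct.Closure.ReflexiveTransitive using (Star; ε; _◅_)
open import Relation.Binary.PropositionalEquality
  using (_≡_; _≢_; refl; sym; trans; cong; cong₂; subst; subst₂; setoid)
open import Relation.Nullary.Decidable using (Dec; yes; no; does; decidable-stable)
open import Relation.Nullary.Negation using (¬_; contradiction)
open import Relation.Unary using (Pred; Decidable)

-- Counting along a list with forbidden successions

module Counting where
  open import Data.List.Base using ([_]; map)
  open import Data.Nat.Base using (_≤_)

  𝟙 : {P : Set} → Dec P → ℕ
  𝟙 P? = if does P? then 1 else 0

  𝟙≤1 : {P : Set} (P? : Dec P) → 𝟙 P? ≤ 1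
  𝟙≤1 (yes _) = ≤-refl
  𝟙≤1 (no _)  = z≤n

  ¬⇒𝟙≡0 : {P : Set} (P? : Dec P) → ¬ P → 𝟙 P? ≡ 0
  ¬⇒𝟙≡0 (yes p) ¬p = contradiction p ¬p
  ¬⇒𝟙≡0 (no _)  _  = refl

  module _ {A : Set} where

    count : {P : Pred A 0ℓ} → Decidable P → List A → ℕ
    count P? = sum ∘ map (𝟙 ∘ P?)

    count-++ : {P : Pred A 0ℓ} (P? : Decidable P) → ∀ xs ys →
               count P? (xs ++ ys) ≡ count P? xs + count P? ys
    count-++ P? xs ys =
      trans (cong sum (map-++ (𝟙 ∘ P?) xs ys)) (sum-++ (map (𝟙 ∘ P?) xs) _)

    count≤length : {P : Pred A 0ℓ} (P? : Decidable P) → ∀ xs →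
                   count P? xs ≤ length xs
    count≤length P? []       = z≤n
    count≤length P? (x ∷ xs) = +-mono-≤ (𝟙≤1 (P? x)) (count≤length P? xs)

    count-none : {P : Pred A 0ℓ} (P? : Decidable P) → ∀ xs →
                 (∀ {x} → x ∈ xs → ¬ P x) → count P? xs ≡ 0
    count-none P? []       none = refl
    count-none P? (x ∷ xs) none =
      cong₂ _+_ (¬⇒𝟙≡0 (P? x) (none (here refl))) (count-none P? xs (none ∘ there))

    module _ {F G : Pred A 0ℓ} (F? : Decidable F) (G? : Decidable G) where

      private
        tally : List A → ℕ
        tally []       = 0
        tally (u ∷ us) = 𝟙 (G? u) + (𝟙 (F? u) + tally us)

        tally≡ : ∀ us → tally us ≡ count F? us + count G? us
        tally≡ []       = refl
        tally≡ (u ∷ us) = trans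
          (cong (λ t → 𝟙 (G? u) + (𝟙 (F? u) + t)) (tally≡ us))
          (solve 4 (λ f g cf cg → g :+ (f :+ (cf :+ cg)) := (f :+ cf) :+ (g :+ cg))
            refl (𝟙 (F? u)) (𝟙 (G? u)) (count F? us) (count G? us))
          where open +-*-Solver

        tally≤ : ∀ u us →
                 (∀ l {v w r} → u ∷ us ≡ l ++ v ∷ w ∷ r → F v → ¬ G w) →
                 (∀ l {v} → u ∷ us ≡ l ++ [ v ] → ¬ F v) →
                 tally (u ∷ us) ≤ 𝟙 (G? u) + length us
        tally≤ u us next last = +-monoʳ-≤ (𝟙 (G? u)) (rest us next last)
          where
          rest : ∀ us →
                 (∀ l {v w r} → u ∷ us ≡ l ++ v ∷ w ∷ r → F v → ¬ G w) →
                 (∀ l {v} → u ∷ us ≡ l ++ [ v ] → ¬ F v) →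
                 𝟙 (F? u) + tally us ≤ length us
          rest [] next last = ≤-reflexive (trans (+-identityʳ _) (¬⇒𝟙≡0 (F? u) (last [] refl)))
          rest (w ∷ us) next last with F? u
          ... | no _   = ≤-trans ih (+-monoˡ-≤ (length us) (𝟙≤1 (G? w)))
            where ih = tally≤ w us (λ l e → next (u ∷ l) (cong (u ∷_) e))
                                   (λ l e → last (u ∷ l) (cong (u ∷_) e))
          ... | yes fu = s≤s (subst (λ g → tally (w ∷ us) ≤ g + length us)
                                    (¬⇒𝟙≡0 (G? w) (next [] refl fu)) ih)
            where ih = tally≤ w us (λ l e → next (u ∷ l) (cong (u ∷_) e))
                                   (λ l e → last (u ∷ l) (cong (u ∷_) e))

      -- Shifting the members of `F` one place to the right keeps them inside the list and off the
      -- members of `G`, so both fit into `length us` places.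
      count₂-≤ : ∀ us →
                 (∀ l {v w r} → us ≡ l ++ v ∷ w ∷ r → F v → ¬ G w) →
                 (∀ l {v} → us ≡ l ++ [ v ] → ¬ F v) →
                 count F? us + count G? us ≤ length us
      count₂-≤ []       _    _    = z≤n
      count₂-≤ (u ∷ us) next last = subst (_≤ suc (length us)) (tally≡ (u ∷ us))
        (≤-trans (tally≤ u us next last) (+-monoˡ-≤ (length us) (𝟙≤1 (G? u))))

    module _ {X Y Z : Pred A 0ℓ}
             (X? : Decidable X) (Y? : Decidable Y) (Z? : Decidable Z) where

      private
        tally : List A → ℕ
        tally []       = 0
        tally (u ∷ us) = 𝟙 (Y? u) + (𝟙 (X? u) + 𝟙 (Z? u) + tally us)

        tally≡ : ∀ us → tally us ≡ count X? us + count Y? us + count Z? us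
        tally≡ []       = refl
        tally≡ (u ∷ us) = trans
          (cong (λ t → 𝟙 (Y? u) + (𝟙 (X? u) + 𝟙 (Z? u) + t)) (tally≡ us))
          (solve 6 (λ x y z cx cy cz →
              y :+ (x :+ z :+ (cx :+ cy :+ cz)) := (x :+ cx) :+ (y :+ cy) :+ (z :+ cz))
            refl (𝟙 (X? u)) (𝟙 (Y? u)) (𝟙 (Z? u)) (count X? us) (count Y? us) (count Z? us))
          where open +-*-Solver

        -- The first place receives no charge, so only membership in `Y` can occupy it.
        slack : List A → ℕ
        slack []      = 0
        slack (u ∷ _) = 𝟙 (Y? u)

        slack≤1 : ∀ us → slack us ≤ 1
        slack≤1 []      = z≤n
        slack≤1 (u ∷ _) = 𝟙≤1 (Y? u)

        slack≡0 : ∀ us → (∀ {v r} → us ≡ v ∷ r → ¬ Y v) → slack us ≡ 0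
        slack≡0 []      _  = refl
        slack≡0 (u ∷ _) ¬y = ¬⇒𝟙≡0 (Y? u) (¬y refl)

        After₁ After₂ : List A → Set
        After₁ us = ∀ l {v w r} → us ≡ l ++ v ∷ w ∷ r →
                    (X v → ¬ Y w) × (Z v → ¬ X w × ¬ Y w × ¬ Z w)
        After₂ us = ∀ l {v w w′ r} → us ≡ l ++ v ∷ w ∷ w′ ∷ r → X v → ¬ Y w′

        tail₁ : ∀ {u us} → After₁ (u ∷ us) → After₁ us
        tail₁ {u} after l e = after (u ∷ l) (cong (u ∷_) e)

        tail₂ : ∀ {u us} → After₂ (u ∷ us) → After₂ us
        tail₂ {u} after l e = after (u ∷ l) (cong (u ∷_) e)

        -- Charging v ∈ X ∪ Z to the vertex after v, and v ∈ X ∩ Z once more to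
        -- the second vertex after v, hits no vertex of Y and no vertex twice.
        tally≤ : ∀ us → After₁ us → After₂ us → tally us ≤ suc (slack us + length us)
        tally≤ []       _      _      = z≤n
        tally≤ (u ∷ us) after₁ after₂ =
          subst (𝟙 (Y? u) + (𝟙 (X? u) + 𝟙 (Z? u) + tally us) ≤_)
            (+-suc (𝟙 (Y? u)) (suc (length us)))
            (+-monoʳ-≤ (𝟙 (Y? u)) rest)
          where
          ih : tally us ≤ suc (slack us + length us)
          ih = tally≤ us (tail₁ after₁) (tail₂ after₂)

          tight : (∀ {v r} → us ≡ v ∷ r → ¬ Y v) → tally us ≤ suc (length us)
          tight ¬y = subst (λ s → tally us ≤ suc (s + length us)) (slack≡0 us ¬y) ih

          -- The vertex after `u` contributes nothing and the second one after `u` is not in `Y`,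
          -- which pays for the second charge of `u`.
          skip : ∀ us → After₁ (u ∷ us) → After₂ (u ∷ us) → X u → Z u →
                 tally us ≤ length us
          skip []       _      _      _  _  = z≤n
          skip (w ∷ us) after₁ after₂ xu zu =
            let ¬xw , ¬yw , ¬zw = proj₂ (after₁ [] refl) zu in
            subst (_≤ suc (length us))
              (sym (cong₂ _+_ (¬⇒𝟙≡0 (Y? w) ¬yw)
                (cong (_+ tally us) (cong₂ _+_ (¬⇒𝟙≡0 (X? w) ¬xw) (¬⇒𝟙≡0 (Z? w) ¬zw)))))
              (subst (λ s → tally us ≤ suc (s + length us))
                (slack≡0 us λ { refl → after₂ [] refl xu })
                (tally≤ us (tail₁ (tail₁ after₁)) (tail₂ (tail₂ after₂))))

          rest : 𝟙 (X? u) + 𝟙 (Z? u) + tally us ≤ suc (suc (length us))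
          rest with X? u | Z? u
          ... | no _   | no _   = ≤-trans ih (s≤s (+-monoˡ-≤ (length us) (slack≤1 us)))
          ... | yes xu | no _   = s≤s (tight λ { refl → proj₁ (after₁ [] refl) xu })
          ... | no _   | yes zu = s≤s (tight λ { refl → proj₁ (proj₂ (proj₂ (after₁ [] refl) zu)) })
          ... | yes xu | yes zu = s≤s (s≤s (skip us after₁ after₂ xu zu))

      -- Charges run at most two places past the end of the list, while the first place stays empty.
      -- This leaves `suc (length us)` places.
      count₃-≤ : ∀ us → (∀ {v r} → us ≡ v ∷ r → ¬ Y v) →
                 (∀ l {v w r} → us ≡ l ++ v ∷ w ∷ r →
                   (X v → ¬ Y w) × (Z v → ¬ X w × ¬ Y w × ¬ Z w)) →
                 (∀ l {v w w′ r} → us ≡ l ++ v ∷ w ∷ w′ ∷ r → X v → ¬ Y w′) →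
                 count X? us + count Y? us + count Z? us ≤ suc (length us)
      count₃-≤ us ¬Y-first after₁ after₂ = subst₂ _≤_ (tally≡ us)
        (cong (λ s → suc (s + length us)) (slack≡0 us ¬Y-first))
        (tally≤ us after₁ after₂)

  ∣p∣≤1+∣p-x∣ : ∀ {n} (p : Subset n) x → ∣ p ∣ ≤ suc ∣ p - x ∣
  ∣p∣≤1+∣p-x∣ (inside  ∷ p) zero    = s≤s (≤-reflexive (cong ∣_∣ (sym (p─⊥≡p p))))
  ∣p∣≤1+∣p-x∣ (outside ∷ p) zero    = m≤n⇒m≤1+n (≤-reflexive (cong ∣_∣ (sym (p─⊥≡p p))))
  ∣p∣≤1+∣p-x∣ (inside  ∷ p) (suc x) = s≤s (∣p∣≤1+∣p-x∣ p x)
  ∣p∣≤1+∣p-x∣ (outside ∷ p) (suc x) = ∣p∣≤1+∣p-x∣ p x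

  x∉p-x : ∀ {n} (p : Subset n) x → x Subset.∉ p - x
  x∉p-x (inside  ∷ p) (suc x) (there x∈) = x∉p-x p x x∈
  x∉p-x (outside ∷ p) (suc x) (there x∈) = x∉p-x p x x∈

  -- Removing the head `x` from `p` costs at most one, paid for by its indicator. If `P x` fails,
  -- then `x` is not in `p` at all.
  ∣p∣≤count : ∀ {n} {P : Pred (Fin n) 0ℓ} (P? : Decidable P) xs (p : Subset n) →
              (∀ {x} → x Subset.∈ p → P x × x ∈ xs) → ∣ p ∣ ≤ count P? xs
  ∣p∣≤count {n} P? [] p p⊆xs = ≤-reflexive
    (trans (cong ∣_∣ (Empty-unique λ (_ , x∈p) → ¬Any[] (proj₂ (p⊆xs x∈p)))) (∣⊥∣≡0 n))
  ∣p∣≤count P? (x ∷ xs) p p⊆xs with P? x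
  ... | yes _  = ≤-trans (∣p∣≤1+∣p-x∣ p x) (s≤s (∣p∣≤count P? xs (p - x) p-x⊆xs))
    where
    p-x⊆xs : ∀ {y} → y Subset.∈ p - x → _ × y ∈ xs
    p-x⊆xs y∈ with p⊆xs (p─q⊆p p ⁅ x ⁆ y∈)
    ... | Py , there y∈xs = Py , y∈xs
    ... | Py , here refl  = contradiction y∈ (x∉p-x p x)
  ... | no ¬Px = ∣p∣≤count P? xs p λ x∈p → drop-head (p⊆xs x∈p)
    where
    drop-head : ∀ {y} → _ × y ∈ x ∷ xs → _ × y ∈ xs
    drop-head (Py , here refl)  = contradiction Py ¬Px
    drop-head (Py , there y∈xs) = Py , y∈xs

open Counting

-- Distinct vertex lists, and paths that are cut, joined and closed

Unique-resp-↭ : ∀ {A : Set} {xs ys : List A} → xs ↭ ys → Unique xs → Unique ys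
Unique-resp-↭ {A} = Permutationₛ.Unique-resp-↭ (setoid A) ∘ ↭⇒↭ₛ

Unique⇒≢ : ∀ {A : Set} {u w : A} xs {ys} → Unique (xs ++ ys) → u ∈ xs → w ∈ ys → u ≢ w
Unique⇒≢ (x ∷ xs) (x∉ ∷ _)   (here refl) w∈ = lookup x∉ (∈-++⁺ʳ xs w∈)
Unique⇒≢ (x ∷ xs) (_ ∷ uniq) (there u∈)  w∈ = Unique⇒≢ xs uniq u∈ w∈

Unique-++⁻ʳ : ∀ {A : Set} (xs : List A) {ys} → Unique (xs ++ ys) → Unique ys
Unique-++⁻ʳ []       uniq       = uniq
Unique-++⁻ʳ (_ ∷ xs) (_ ∷ uniq) = Unique-++⁻ʳ xs uniq

module Walks {n : ℕ} (G : Graph n) where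
  open import Data.List.Base using ([_])
  open import Data.Nat.Base using (_≤_; _<_)
  open Graph G

  private variable
    a b u v w w′ : Fin n
    xs ys zs : List (Fin n)

  -- The form in which the bound on σ₃ is used. It also covers σ₃ = +∞, where it holds vacuously.
  IndependentTriples≥ : ℕ → Set
  IndependentTriples≥ k = ∀ {x y z} → x ≢ y → x ≢ z → y ≢ z → ¬ x ~ y → ¬ x ~ z → ¬ y ~ z →
                          k ≤ degree G x + degree G y + degree G z

  degree≤count : (∀ {w} → v ~ w → w ∈ xs) → degree G v ≤ count (v ~?_) xs
  degree≤count {v} {xs} N⊆xs = ∣p∣≤count (v ~?_) xs (neighbourhood G v) λ {w} w∈N →
    let v~w = adjacent w ([]=⇒lookup w∈N) in v~w , N⊆xs v~w
    where
    adjacent : ∀ w → Vec.lookup (neighbourhood G v) w ≡ true → v ~ w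
    adjacent w eq with v ~? w | trans (sym (lookup∘tabulate (λ u → does (v ~? u)) w)) eq
    ... | yes v~w | _  = v~w
    ... | no _    | ()

  -- Distinctness is kept apart, as a property of the vertex list that survives permutation.
  data Path : Fin n → Fin n → List (Fin n) → Set where
    end : ∀ u → Path u u [ u ]
    _∷_ : u ~ w → Path w v xs → Path u v (u ∷ xs)

  fromLinked : ∀ u us → Linked _~_ (u ∷ us) → ∃[ v ] Path u v (u ∷ us)
  fromLinked u []       [-]      = u , end u
  fromLinked u (w ∷ us) (e ∷ es) = let v , P = fromLinked w us es in v , e ∷ P

  toLinked : Path u v xs → Linked _~_ xs
  toLinked (end u)       = [-]
  toLinked (e ∷ end u)   = e ∷ [-]
  toLinked (e ∷ (f ∷ P)) = e ∷ toLinked (f ∷ P)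

  toLinked-∷ʳ : Path u v xs → v ~ w → Linked _~_ (xs ∷ʳ w)
  toLinked-∷ʳ (end u)       f = f ∷ [-]
  toLinked-∷ʳ (e ∷ end u)   f = e ∷ f ∷ [-]
  toLinked-∷ʳ (e ∷ (g ∷ P)) f = e ∷ toLinked-∷ʳ (g ∷ P) f

  path-nonempty : Path u v xs → 0 < length xs
  path-nonempty (end u) = s≤s z≤n
  path-nonempty (e ∷ P) = s≤s z≤n

  path-first : Path u v (w ∷ xs) → u ≡ w
  path-first (end u) = refl
  path-first (e ∷ P) = refl

  path-last : Path u v xs → ∀ l → xs ≡ l ++ [ w ] → v ≡ w
  path-last (end u)     []          refl = refl
  path-last (end u)     (_ ∷ [])    ()
  path-last (end u)     (_ ∷ _ ∷ _) ()
  path-last (e ∷ end _) []          ()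
  path-last (e ∷ P)     (_ ∷ l)     eq = path-last P l (∷-injectiveʳ eq)
  path-last (e ∷ (_ ∷ _)) []        ()

  first∈ : Path u v xs → u ∈ xs
  first∈ (end u) = here refl
  first∈ (e ∷ P) = here refl

  last∈ : Path u v xs → v ∈ xs
  last∈ (end u) = here refl
  last∈ (e ∷ P) = there (last∈ P)

  unsnoc : u ~ w → Path w v xs →
           ∃₂ λ b ys → Path u b ys × b ~ v × u ∷ xs ≡ ys ++ [ v ]
  unsnoc {u} e (end v) = u , [ u ] , end u , e , refl
  unsnoc {u} e (f ∷ P) with b , ys , Q , g , eq ← unsnoc f P =
    b , u ∷ ys , e ∷ Q , g , cong (u ∷_) eq

  record Cut (u w w′ v : Fin n) (xs : List (Fin n)) : Set where
    constructor cut
    field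
      {J K} : List (Fin n)
      left  : Path u w J
      step  : w ~ w′
      right : Path w′ v K
      split : xs ≡ J ++ K

  _∷ᶜ_ : u ~ a → Cut a w w′ v xs → Cut u w w′ v (u ∷ xs)
  e ∷ᶜ cut P f Q eq = cut (e ∷ P) f Q (cong (_ ∷_) eq)

  cutBetween : Path u v xs → ∀ l {r} → xs ≡ l ++ w ∷ w′ ∷ r → Cut u w w′ v xs
  cutBetween (end u)     []          ()
  cutBetween (end u)     (_ ∷ [])    ()
  cutBetween (end u)     (_ ∷ _ ∷ _) ()
  cutBetween (e ∷ P)     []          refl with refl ← path-first P = cut (end _) e P refl
  cutBetween (e ∷ P)     (_ ∷ l)     refl = e ∷ᶜ cutBetween P l refl

  -- The two pieces leave out `c`. Rerouting through them can yield a cycle of order p - 1.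
  cutAround : Path u v xs → ∀ l {c r} → xs ≡ l ++ w ∷ c ∷ w′ ∷ r →
              ∃₂ λ ys zs → Path u w ys × Path w′ v zs × xs ≡ ys ++ [ c ] ++ zs
  cutAround (end u)         []          ()
  cutAround (end u)         (_ ∷ [])    ()
  cutAround (end u)         (_ ∷ _ ∷ _) ()
  cutAround (e ∷ end _)     []          ()
  cutAround (e ∷ (f ∷ P))   []          refl with refl ← path-first P =
    _ , _ , end _ , P , refl
  cutAround (e ∷ P)         (c ∷ l)     eq
    with refl ← ∷-injectiveˡ eq | ys , zs , L , R , eq′ ← cutAround P l (∷-injectiveʳ eq) =
    c ∷ ys , zs , e ∷ L , R , cong (c ∷_) eq′

  cutBefore : Path u v xs → w ∈ xs → u ≡ w ⊎ ∃[ a ] Cut u a w v xs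
  cutBefore (end u) (here refl) = inj₁ refl
  cutBefore (e ∷ P) (here refl) = inj₁ refl
  cutBefore (e ∷ P) (there w∈) with cutBefore P w∈
  ... | inj₁ refl    = inj₂ (_ , cut (end _) e P refl)
  ... | inj₂ (a , c) = inj₂ (a , e ∷ᶜ c)

  cutAfter : Path u v xs → w ∈ xs → v ≡ w ⊎ ∃[ a ] Cut u w a v xs
  cutAfter (end u) (here refl) = inj₁ refl
  cutAfter (e ∷ P) (here refl) = inj₂ (_ , cut (end _) e P refl)
  cutAfter (e ∷ P) (there w∈) with cutAfter P w∈
  ... | inj₁ eq      = inj₁ eq
  ... | inj₂ (a , c) = inj₂ (a , e ∷ᶜ c)

  -- A path whose vertices, in some order, are xs.
  Path↭ : Fin n → Fin n → List (Fin n) → Set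
  Path↭ u v xs = ∃[ ys ] Path u v ys × ys ↭ xs

  ⌊_⌋ : Path u v xs → Path↭ u v xs
  ⌊ P ⌋ = _ , P , ↭-refl

  infixr 5 _⟨_⟩_
  infix 8 _⁻¹

  -- A chain of these spells out a rerouted path segment by segment. Comparing its vertices with the
  -- original ones is left to the commutative monoid solver.
  _⟨_⟩_ : Path↭ u v xs → v ~ w → Path↭ w b ys → Path↭ u b (xs ++ ys)
  (_ , P , σ) ⟨ e ⟩ (_ , Q , τ) = _ , join P e Q , ++⁺ σ τ
    where
    join : Path u v xs → v ~ w → Path w b ys → Path u b (xs ++ ys)
    join (end u) e Q = e ∷ Q
    join (f ∷ P) e Q = f ∷ join P e Q

  resp : xs ↭ ys → Path↭ u v xs → Path↭ u v ys
  resp τ (_ , P , σ) = _ , P , ↭-trans σ τ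

  _⁻¹ : Path↭ u v xs → Path↭ v u xs
  (_ , P , σ) ⁻¹ = resp σ (reversed P)
    where
    reversed : Path u v xs → Path↭ v u xs
    reversed (end u)               = ⌊ end u ⌋
    reversed (_∷_ {u = u} {xs = xs} e P) =
      resp (++-comm xs [ u ]) (reversed P ⟨ ~-sym e ⟩ ⌊ end u ⌋)

  closing : Path u v xs → v ~ u → Unique xs → IsCycle G xs
  closing (end u)             v~u uniq = contradiction v~u (~-irrefl refl)
  -- A closed path on two vertices is a cycle by the convention on edges.
  closing (e ∷ end _)         v~u uniq = edge e
  closing P@(_ ∷ (_ ∷ Q))     v~u uniq =
    cycle (s≤s (s≤s (path-nonempty Q))) uniq (toLinked-∷ʳ P v~u)

-- Longest paths when every cycle has order at most p - 2

module LongestPath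
  {n : ℕ} (G : Graph n) (p : ℕ)
  (longest : ∀ {vs} → IsPath G vs → length vs ℕ.≤ p)
  (cycles-short : ∀ {vs} → IsCycle G vs → 2 + length vs ℕ.≤ p)
  (σ₃-bound : Walks.IndependentTriples≥ G (p + 2))
  where

  open import Data.List.Base using ([_])
  open import Data.Nat.Base using (_≤_; _<_)
  open Graph G
  open Walks G
  open DecMembership (Fin._≟_ {n}) using (_∈?_)
  open CommutativeMonoidSolver (++-commutativeMonoid {A = Fin n}) using (solve; _⊕_; _⊜_)

  private variable
    a b s t u u′ v w x y z : Fin n
    xs ys zs ws : List (Fin n)

  -- Any path on such a list is a longest path, so every rerouting on the same vertices is one as
  -- well.
  Full : List (Fin n) → Set
  Full xs = Unique xs × length xs ≡ p

  full-resp : xs ↭ ys → Full xs → Full ys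
  full-resp σ (uniq , len) = Unique-resp-↭ σ uniq , trans (sym (↭-length σ)) len

  -- Otherwise prepending `w` gives a path of order p + 1.
  end-neighbour : Path↭ u v xs → Full xs → u ~ w → w ∈ xs
  end-neighbour {u = u} {xs = xs} {w = w} (ys , P , σ) full u~w with w ∈? ys
  ... | yes w∈ys = ∈-resp-↭ σ w∈ys
  ... | no  w∉ys with uniq , len ← full-resp (↭-sym σ) full =
    contradiction (subst (_< p) len (longest record
      { nonempty = λ ()
      ; distinct = ¬Any⇒All¬ ys w∉ys ∷ uniq
      ; linked   = toLinked (~-sym u~w ∷ P)
      })) (<-irrefl refl)

  no-cycle : Path↭ u v xs → v ~ u → xs ↭ ws → Full ws → ⊥
  no-cycle (ys , P , σ) v~u τ full with uniq , len ← full-resp (↭-sym (↭-trans σ τ)) full =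
    m+n≮n 1 p (subst (λ l → 2 + l ≤ p) len (cycles-short (closing P v~u uniq)))

  no-cycle₁ : Path↭ u v xs → v ~ u → w ∷ xs ↭ ws → Full ws → ⊥
  no-cycle₁ (ys , P , σ) v~u τ full
    with _ ∷ uniq , len ← full-resp (↭-sym (↭-trans (prep _ σ) τ)) full =
    <-irrefl len (cycles-short (closing P v~u uniq))

  -- Orders p and p - 1 are both excluded for cycles; `zs` lists the at most one vertex missed.
  bypass : ∀ zs → length zs ≤ 1 →
           Path↭ u v xs → v ~ u → zs ++ xs ↭ ws → Full ws → ⊥
  bypass []          _        = no-cycle
  bypass (z ∷ [])    _        = no-cycle₁
  bypass (_ ∷ _ ∷ _) (s≤s ())

  -- The arcs y … b and x … a form the cycle; the index lists the path s … t
  -- attached to it, whose length decreases in the induction.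
  data Theta : List (Fin n) → Set where
    theta : Path↭ y b xs → Path↭ x a ys → Path↭ s t zs →
            a ~ y → b ~ x → a ~ s → t ~ b → Full (xs ++ ys ++ zs) → Theta zs

  -- The degree sum at a theta with shortest attached path

  module ThetaStep
    {y b x a s s′ t : Fin n} {I₁ I₂ S : List (Fin n)}
    (P₁ : Path y b I₁) (P₂ : Path x a I₂) (s~s′ : s ~ s′) (Q : Path s′ t S)
    (a~y : a ~ y) (b~x : b ~ x) (a~s : a ~ s) (t~b : t ~ b)
    (full : Full (I₁ ++ I₂ ++ s ∷ S))
    (ih : ∀ {zs} → length zs < length (s ∷ S) → ¬ Theta zs)
    where

    sQ : Path s t (s ∷ S)
    sQ = s~s′ ∷ Q

    S-shorter : ∀ {zs} → length zs ≤ length S → ¬ Theta zs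
    S-shorter le = ih (s≤s le)

    -- The cycle x ... a s ... t b ... y would have order p.
    x≁y : ¬ x ~ y
    x≁y x~y = no-cycle
      (⌊ P₂ ⌋ ⟨ a~s ⟩ ⌊ sQ ⌋ ⟨ t~b ⟩ ⌊ P₁ ⌋ ⁻¹) (~-sym x~y)
      (solve 3 (λ I₁ I₂ S → I₂ ⊕ S ⊕ I₁ ⊜ I₁ ⊕ I₂ ⊕ S) ↭-refl I₁ I₂ (s ∷ S)) full

    -- If `w` is `s`, there is a cycle of order p. Otherwise w ... t can be moved into the arc
    -- ending in `b`, and the attached path gets shorter.
    x≁S : w ∈ s ∷ S → ¬ x ~ w
    x≁S w∈S x~w with cutBefore sQ w∈S
    ... | inj₁ refl = no-cycle
      (⌊ P₂ ⌋ ⟨ a~y ⟩ ⌊ P₁ ⌋ ⟨ ~-sym t~b ⟩ ⌊ sQ ⌋ ⁻¹) (~-sym x~w)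
      (solve 3 (λ I₁ I₂ S → I₂ ⊕ I₁ ⊕ S ⊜ I₁ ⊕ I₂ ⊕ S) ↭-refl I₁ I₂ (s ∷ S)) full
    ... | inj₂ (_ , cut {J} {K} L e R eq) =
      ih (subst (length J <_) (sym (trans (cong length eq) (length-++ J)))
            (m<m+n (length J) (path-nonempty R)))
        (theta (⌊ P₁ ⌋ ⟨ ~-sym t~b ⟩ ⌊ R ⌋ ⁻¹) ⌊ P₂ ⌋ ⌊ L ⌋ a~y (~-sym x~w) a~s e
          (full-resp (↭-trans (++⁺ˡ I₁ (++⁺ˡ I₂ (↭-reflexive eq)))
            (solve 4 (λ I₁ I₂ J K → I₁ ⊕ I₂ ⊕ J ⊕ K ⊜ (I₁ ⊕ K) ⊕ I₂ ⊕ J)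
              ↭-refl I₁ I₂ J K)) full))

    -- Symmetrically, s ... w moves into the arc ending in `a`, unless `w` is `t`.
    y≁S : w ∈ s ∷ S → ¬ y ~ w
    y≁S w∈S y~w with cutAfter sQ w∈S
    ... | inj₁ refl = no-cycle
      (⌊ P₁ ⌋ ⟨ b~x ⟩ ⌊ P₂ ⌋ ⟨ a~s ⟩ ⌊ sQ ⌋) (~-sym y~w) ↭-refl full
    ... | inj₂ (_ , cut {J} {K} L e R eq) =
      ih (subst (length K <_) (sym (trans (cong length eq) (length-++ J)))
            (m<n+m (length K) (path-nonempty L)))
        (theta ⌊ P₁ ⌋ (⌊ P₂ ⌋ ⟨ a~s ⟩ ⌊ L ⌋) ⌊ R ⌋ (~-sym y~w) b~x e t~b
          (full-resp (↭-trans (++⁺ˡ I₁ (++⁺ˡ I₂ (↭-reflexive eq)))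
            (solve 4 (λ I₁ I₂ J K → I₁ ⊕ I₂ ⊕ J ⊕ K ⊜ I₁ ⊕ (I₂ ⊕ J) ⊕ K)
              ↭-refl I₁ I₂ J K)) full))

    -- In each of the following, u′ follows u on an arc of the cycle, with the
    -- vertices ws in between, and xu-yu′ says that x ~ u excludes y ~ u′.
    module Arc₁ {u u′ : Fin n} {J K : List (Fin n)} (L : Path y u J) (R : Path u′ b K) where

      -- The cycle u ... y u′ ... b t ... s a ... x would miss only `ws`.
      xu-yu′ : ∀ ws → I₁ ↭ J ++ ws ++ K → length ws ≤ 1 → x ~ u → ¬ y ~ u′
      xu-yu′ ws σ short x~u y~u′ = bypass ws short
        (⌊ L ⌋ ⁻¹ ⟨ y~u′ ⟩ ⌊ R ⌋ ⟨ ~-sym t~b ⟩ ⌊ sQ ⌋ ⁻¹ ⟨ ~-sym a~s ⟩ ⌊ P₂ ⌋ ⁻¹) x~u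
        (↭-trans (solve 5 (λ ws J K I₂ S → ws ⊕ J ⊕ K ⊕ S ⊕ I₂ ⊜ (J ⊕ ws ⊕ K) ⊕ I₂ ⊕ S)
            ↭-refl ws J K I₂ (s ∷ S))
          (++⁺ʳ _ (↭-sym σ)))
        full

      module _ (I₁≡ : I₁ ≡ J ++ K) where

        J++K-full : Full ((J ++ K) ++ I₂ ++ s ∷ S)
        J++K-full = subst (λ I → Full (I ++ I₂ ++ s ∷ S)) I₁≡ full

        su-xu′ : s ~ u → ¬ x ~ u′
        su-xu′ s~u x~u′ = no-cycle
          (⌊ L ⌋ ⟨ ~-sym s~u ⟩ ⌊ sQ ⌋ ⟨ t~b ⟩ ⌊ R ⌋ ⁻¹ ⟨ ~-sym x~u′ ⟩ ⌊ P₂ ⌋) a~y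
          (solve 4 (λ J K I₂ S → J ⊕ S ⊕ K ⊕ I₂ ⊜ (J ⊕ K) ⊕ I₂ ⊕ S)
            ↭-refl J K I₂ (s ∷ S)) J++K-full

        -- The cycle u ... y u′ ... b x ... a s would absorb `s`, leaving the attached path s′ ...
        -- t.
        su-yu′ : s ~ u → ¬ y ~ u′
        su-yu′ s~u y~u′ = S-shorter ≤-refl
          (theta (⌊ L ⌋ ⁻¹ ⟨ y~u′ ⟩ ⌊ R ⌋) (⌊ P₂ ⌋ ⟨ a~s ⟩ ⌊ end s ⌋) ⌊ Q ⌋
            s~u b~x s~s′ t~b
            (full-resp (solve 5 (λ J K I₂ s S → (J ⊕ K) ⊕ I₂ ⊕ s ⊕ S ⊜ (J ⊕ K) ⊕ (I₂ ⊕ s) ⊕ S)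
              ↭-refl J K I₂ [ s ] S) J++K-full))

        -- Otherwise `s` can be inserted between `u` and `u′`.
        su-su′ : s ~ u → ¬ s ~ u′
        su-su′ s~u s~u′ = S-shorter ≤-refl
          (theta ⌊ R ⌋ (⌊ P₂ ⌋ ⟨ a~y ⟩ ⌊ L ⌋ ⟨ ~-sym s~u ⟩ ⌊ end s ⌋) ⌊ Q ⌋
            s~u′ b~x s~s′ t~b
            (full-resp (solve 5 (λ J K I₂ s S → (J ⊕ K) ⊕ I₂ ⊕ s ⊕ S ⊜ K ⊕ (I₂ ⊕ J ⊕ s) ⊕ S)
              ↭-refl J K I₂ [ s ] S) J++K-full))

    module Arc₂ {u u′ : Fin n} {J K : List (Fin n)} (L : Path x u J) (R : Path u′ a K) where

      yu-xu′ : ∀ ws → I₂ ↭ J ++ ws ++ K → length ws ≤ 1 → y ~ u → ¬ x ~ u′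
      yu-xu′ ws σ short y~u x~u′ = bypass ws short
        (⌊ L ⌋ ⁻¹ ⟨ x~u′ ⟩ ⌊ R ⌋ ⟨ a~s ⟩ ⌊ sQ ⌋ ⟨ t~b ⟩ ⌊ P₁ ⌋ ⁻¹) y~u
        (↭-trans (solve 5 (λ ws J K I₁ S → ws ⊕ J ⊕ K ⊕ S ⊕ I₁ ⊜ I₁ ⊕ (J ⊕ ws ⊕ K) ⊕ S)
            ↭-refl ws J K I₁ (s ∷ S))
          (++⁺ˡ I₁ (++⁺ʳ _ (↭-sym σ))))
        full

      module _ (I₂≡ : I₂ ≡ J ++ K) where

        J++K-full : Full (I₁ ++ (J ++ K) ++ s ∷ S)
        J++K-full = subst (λ I → Full (I₁ ++ I ++ s ∷ S)) I₂≡ full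

        su-xu′ : s ~ u → ¬ x ~ u′
        su-xu′ s~u x~u′ = no-cycle
          (⌊ L ⌋ ⁻¹ ⟨ x~u′ ⟩ ⌊ R ⌋ ⟨ a~y ⟩ ⌊ P₁ ⌋ ⟨ ~-sym t~b ⟩ ⌊ sQ ⌋ ⁻¹) s~u
          (solve 4 (λ J K I₁ S → J ⊕ K ⊕ I₁ ⊕ S ⊜ I₁ ⊕ (J ⊕ K) ⊕ S)
            ↭-refl J K I₁ (s ∷ S)) J++K-full

        -- Here the edge from `s` to `a` closes the new cycle a ... u′ y ... b x ... u s.
        su-yu′ : s ~ u → ¬ y ~ u′
        su-yu′ s~u y~u′ = S-shorter ≤-refl
          (theta (⌊ R ⌋ ⁻¹ ⟨ ~-sym y~u′ ⟩ ⌊ P₁ ⌋) (⌊ L ⌋ ⟨ ~-sym s~u ⟩ ⌊ end s ⌋) ⌊ Q ⌋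
            (~-sym a~s) b~x s~s′ t~b
            (full-resp (solve 5 (λ J K I₁ s S → I₁ ⊕ (J ⊕ K) ⊕ s ⊕ S ⊜ (K ⊕ I₁) ⊕ (J ⊕ s) ⊕ S)
              ↭-refl J K I₁ [ s ] S) J++K-full))

        su-su′ : s ~ u → ¬ s ~ u′
        su-su′ s~u s~u′ = S-shorter ≤-refl
          (theta (⌊ R ⌋ ⟨ a~y ⟩ ⌊ P₁ ⌋) (⌊ L ⌋ ⟨ ~-sym s~u ⟩ ⌊ end s ⌋) ⌊ Q ⌋
            s~u′ b~x s~s′ t~b
            (full-resp (solve 5 (λ J K I₁ s S → I₁ ⊕ (J ⊕ K) ⊕ s ⊕ S ⊜ (K ⊕ I₁) ⊕ (J ⊕ s) ⊕ S)
              ↭-refl J K I₁ [ s ] S) J++K-full))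

    arc₁-count : count (x ~?_) I₁ + count (y ~?_) I₁ + count (s ~?_) I₁ ≤ suc (length I₁)
    arc₁-count = count₃-≤ (x ~?_) (y ~?_) (s ~?_) I₁
      (λ e → ~-irrefl (path-first (subst (Path y b) e P₁)))
      (λ l e → let cut L _ R I₁≡ = cutBetween P₁ l e in
        Arc₁.xu-yu′ L R [] (↭-reflexive I₁≡) z≤n ,
        λ s~u → Arc₁.su-xu′ L R I₁≡ s~u , Arc₁.su-yu′ L R I₁≡ s~u , Arc₁.su-su′ L R I₁≡ s~u)
      (λ l {w = c} e → let _ , _ , L , R , I₁≡ = cutAround P₁ l e in
        Arc₁.xu-yu′ L R [ c ] (↭-reflexive I₁≡) ≤-refl)

    -- This arc starts in `x`, so `x` and `y` exchange roles in the count.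
    arc₂-count : count (y ~?_) I₂ + count (x ~?_) I₂ + count (s ~?_) I₂ ≤ suc (length I₂)
    arc₂-count = count₃-≤ (y ~?_) (x ~?_) (s ~?_) I₂
      (λ e → ~-irrefl (path-first (subst (Path x a) e P₂)))
      (λ l e → let cut L _ R I₂≡ = cutBetween P₂ l e in
        Arc₂.yu-xu′ L R [] (↭-reflexive I₂≡) z≤n ,
        λ s~u → Arc₂.su-yu′ L R I₂≡ s~u , Arc₂.su-xu′ L R I₂≡ s~u , Arc₂.su-su′ L R I₂≡ s~u)
      (λ l {w = c} e → let _ , _ , L , R , I₂≡ = cutAround P₂ l e in
        Arc₂.yu-xu′ L R [ c ] (↭-reflexive I₂≡) ≤-refl)

    count-split : ∀ v → count (v ~?_) (I₁ ++ I₂ ++ s ∷ S) ≡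
                  count (v ~?_) I₁ + (count (v ~?_) I₂ + count (v ~?_) (s ∷ S))
    count-split v = trans (count-++ (v ~?_) I₁ _)
      (cong (count (v ~?_) I₁ +_) (count-++ (v ~?_) I₂ _))

    degree≤ : ∀ v {k} → Path↭ v w xs → xs ↭ I₁ ++ I₂ ++ s ∷ S →
              count (v ~?_) (s ∷ S) ≤ k →
              degree G v ≤ count (v ~?_) I₁ + (count (v ~?_) I₂ + k)
    degree≤ v P σ le = ≤-trans
      (degree≤count λ v~w → ∈-resp-↭ σ (end-neighbour P (full-resp (↭-sym σ) full) v~w))
      (≤-trans (≤-reflexive (count-split v)) 
        (+-monoʳ-≤ (count (v ~?_) I₁) (+-monoʳ-≤ (count (v ~?_) I₂) le)))

    degree-x : degree G x ≤ count (x ~?_) I₁ + (count (x ~?_) I₂ + 0)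
    degree-x = degree≤ x (⌊ P₂ ⌋ ⟨ a~y ⟩ ⌊ P₁ ⌋ ⟨ ~-sym t~b ⟩ ⌊ sQ ⌋ ⁻¹)
      (solve 3 (λ I₁ I₂ S → I₂ ⊕ I₁ ⊕ S ⊜ I₁ ⊕ I₂ ⊕ S) ↭-refl I₁ I₂ (s ∷ S))
      (≤-reflexive (count-none (x ~?_) (s ∷ S) x≁S))

    degree-y : degree G y ≤ count (y ~?_) I₁ + (count (y ~?_) I₂ + 0)
    degree-y = degree≤ y (⌊ P₁ ⌋ ⟨ b~x ⟩ ⌊ P₂ ⌋ ⟨ a~s ⟩ ⌊ sQ ⌋) ↭-refl
      (≤-reflexive (count-none (y ~?_) (s ∷ S) y≁S))

    degree-s : degree G s ≤ count (s ~?_) I₁ + (count (s ~?_) I₂ + length S)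
    degree-s = degree≤ s (⌊ sQ ⌋ ⟨ t~b ⟩ ⌊ P₁ ⌋ ⁻¹ ⟨ ~-sym a~y ⟩ ⌊ P₂ ⌋ ⁻¹)
      (solve 3 (λ I₁ I₂ S → S ⊕ I₁ ⊕ I₂ ⊜ I₁ ⊕ I₂ ⊕ S) ↭-refl I₁ I₂ (s ∷ S))
      -- Since `s` is not its own neighbour, `s ∷ S` contributes at most `length S`.
      (+-mono-≤ (≤-reflexive (¬⇒𝟙≡0 (s ~? s) (~-irrefl refl))) (count≤length (s ~?_) S))

    degree-sum : degree G x + degree G y + degree G s ≤ suc p
    degree-sum = begin
      degree G x + degree G y + degree G s
        ≤⟨ +-mono-≤ (+-mono-≤ degree-x degree-y) degree-s ⟩
      (x₁ + (x₂ + 0)) + (y₁ + (y₂ + 0)) + (s₁ + (s₂ + length S))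
        ≡⟨ solve′ 7 (λ x₁ x₂ y₁ y₂ s₁ s₂ l →
             (x₁ :+ (x₂ :+ con 0)) :+ (y₁ :+ (y₂ :+ con 0)) :+ (s₁ :+ (s₂ :+ l)) :=
             (x₁ :+ y₁ :+ s₁) :+ ((y₂ :+ x₂ :+ s₂) :+ l))
             refl x₁ x₂ y₁ y₂ s₁ s₂ (length S) ⟩
      (x₁ + y₁ + s₁) + ((y₂ + x₂ + s₂) + length S)
        ≤⟨ +-mono-≤ arc₁-count (+-monoˡ-≤ (length S) arc₂-count) ⟩
      suc (length I₁) + (suc (length I₂) + length S)
        -- Each arc exceeds its length by one. The place of `s` absorbs one of these units, so p + 1
        -- remains.
        ≡⟨ cong suc (trans (cong (length I₁ +_)
             (trans (sym (+-suc (length I₂) (length S))) (sym (length-++ I₂))))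
             (trans (sym (length-++ I₁)) (proj₂ full))) ⟩
      suc p ∎
      where
      open ≤-Reasoning
      open +-*-Solver using (_:+_; _:=_; con) renaming (solve to solve′)
      x₁ = count (x ~?_) I₁ ; x₂ = count (x ~?_) I₂
      y₁ = count (y ~?_) I₁ ; y₂ = count (y ~?_) I₂
      s₁ = count (s ~?_) I₁ ; s₂ = count (s ~?_) I₂

    impossible : ⊥
    impossible = m+n≮n 0 _ (≤-trans (≤-reflexive (+-comm 2 p)) (≤-trans
      (σ₃-bound
        (λ x≡y → Unique⇒≢ I₁ uniq (first∈ P₁) (∈-++⁺ˡ (first∈ P₂)) (sym x≡y))
        (Unique⇒≢ I₂ (Unique-++⁻ʳ I₁ uniq) (first∈ P₂) (here refl))
        (Unique⇒≢ I₁ uniq (first∈ P₁) (∈-++⁺ʳ I₂ (here refl)))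
        x≁y (x≁S (here refl)) (y≁S (here refl)))
      degree-sum))
      where
      uniq = proj₁ full

  -- Induction on the bound `m`. If the attached path is a single vertex, the cycle of the theta
  -- already has order p - 1.
  no-theta : ∀ m → length zs ≤ m → ¬ Theta zs
  no-theta zero le (theta (_ , P₁ , σ) (_ , P₂ , τ) (_ , end s , υ) a~y b~x a~s t~b full) =
    contradiction (≤-trans (≤-reflexive (↭-length υ)) le) λ ()
  no-theta zero le (theta (_ , P₁ , σ) (_ , P₂ , τ) (_ , e ∷ Q , υ) a~y b~x a~s t~b full) =
    contradiction (≤-trans (≤-reflexive (↭-length υ)) le) λ ()
  no-theta (suc m) le (theta {xs = xs} {ys = ys} P₁ P₂ (_ , end s , υ) a~y b~x _ _ full) =
    no-cycle₁ (P₁ ⟨ b~x ⟩ P₂) a~y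
      (↭-trans (solve 3 (λ I₁ I₂ s → s ⊕ I₁ ⊕ I₂ ⊜ I₁ ⊕ I₂ ⊕ s) ↭-refl xs ys [ s ])
        (++⁺ˡ xs (++⁺ˡ ys υ)))
      full
  no-theta (suc m) le (theta (_ , P₁ , σ) (_ , P₂ , τ) (_ , e ∷ Q , υ) a~y b~x a~s t~b full) =
    ThetaStep.impossible P₁ P₂ e Q a~y b~x a~s t~b
      (full-resp (↭-sym (++⁺ σ (++⁺ τ υ))) full)
      λ shorter → no-theta m (≤-pred (≤-trans shorter (≤-trans (≤-reflexive (↭-length υ)) le)))

  -- Lollipops: the closed path x ... v with the tail w ... y

  module LollipopStep
    (bridge : ∀ v {u w} → u ≢ v → w ≢ v → ¬ ¬ Star (AdjacentOutside G ⁅ v ⁆) u w)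
    {x v w y : Fin n} {H B : List (Fin n)}
    (P : Path x v H) (v~w : v ~ w) (Q : Path w y B) (x~v : x ~ v)
    (full : Full (H ++ B))
    (ih : ∀ {x v w H B′} → length B′ < length B →
          Path↭ x v H → v ~ w → Path w y B′ → x ~ v → ¬ Full (H ++ B′))
    where

    -- Such a `u` can replace `x` as the first vertex of the longest path.
    IsEnd : Fin n → Set
    IsEnd u = Path↭ u v H

    -- If `u′` is `y`, there is a cycle of order p. Otherwise closing up at `u′` gives a lollipop
    -- with a shorter tail.
    end≁B : IsEnd u → u′ ∈ B → ¬ u ~ u′
    end≁B L u′∈B u~u′ with cutAfter Q u′∈B
    ... | inj₁ refl = no-cycle (L ⟨ v~w ⟩ ⌊ Q ⌋) (~-sym u~u′) ↭-refl full
    ... | inj₂ (_ , cut {J} {K} Q₁ e Q₂ eq) =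
      ih (subst (length K <_) (sym (trans (cong length eq) (length-++ J)))
            (m<n+m (length K) (path-nonempty Q₁)))
         (L ⟨ v~w ⟩ ⌊ Q₁ ⌋) e Q₂ u~u′
         (full-resp (↭-trans (++⁺ˡ H (↭-reflexive eq)) (↭-sym (↭-reflexive (++-assoc H J K)))) full)

    end-neighbour∈H : IsEnd u → u ~ u′ → u′ ∈ H
    end-neighbour∈H L u~u′ with ∈-++⁻ H (end-neighbour (L ⟨ v~w ⟩ ⌊ Q ⌋) full u~u′)
    ... | inj₁ u′∈H = u′∈H
    ... | inj₂ u′∈B = contradiction u~u′ (end≁B L u′∈B)

    H∌B : u ∈ H → ¬ u ∈ B
    H∌B u∈H u∈B = Unique⇒≢ H (proj₁ full) u∈H u∈B refl

    -- A neighbour `u` of `y` just before `v` gives a cycle of order p. An earlier one gives a theta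
    -- whose attached path lies strictly between `u` and `v`.
    y-neighbour : y ~ u → u ∈ v ∷ B
    y-neighbour y~u with ∈-++⁻ H (∈-resp-↭ (++-comm B H) (end-neighbour
      (⌊ Q ⌋ ⁻¹ ⟨ ~-sym v~w ⟩ ⌊ P ⌋ ⁻¹) (full-resp (++-comm H B) full) y~u))
    ... | inj₂ u∈B = there u∈B
    ... | inj₁ u∈H with cutAfter P u∈H
    ...   | inj₁ refl = here refl
    ...   | inj₂ (_ , cut {J} L e (end _) eq) = ⊥-elim (no-cycle
            (⌊ L ⌋ ⟨ ~-sym y~u ⟩ ⌊ Q ⌋ ⁻¹ ⟨ ~-sym v~w ⟩ ⌊ end v ⌋) (~-sym x~v)
            (↭-trans (solve 3 (λ J B v → J ⊕ B ⊕ v ⊜ (J ⊕ v) ⊕ B) ↭-refl J B [ v ])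
              (++⁺ʳ B (↭-sym (↭-reflexive eq))))
            full)
    ...   | inj₂ (_ , cut {J} L e (f ∷ R) eq)
      with _ , K , R′ , g , eq′ ← unsnoc f R = ⊥-elim (no-theta _ ≤-refl
        (theta (⌊ Q ⌋ ⁻¹ ⟨ ~-sym v~w ⟩ ⌊ end v ⌋) ⌊ L ⌋ ⌊ R′ ⌋ (~-sym y~u) (~-sym x~v) e g
          (full-resp (↭-trans (++⁺ʳ B (↭-reflexive (trans eq (cong (J ++_) eq′))))
            (solve 4 (λ J K v B → (J ⊕ K ⊕ v) ⊕ B ⊜ (B ⊕ v) ⊕ J ⊕ K) ↭-refl J K [ v ] B))
            full)))

    degree-y : degree G y ≤ suc (length B)
    degree-y = ≤-trans (degree≤count y-neighbour) (count≤length (y ~?_) (v ∷ B))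

    -- If u is an end but its successor u′ is not, consider the predecessor b of
    -- v, also an end.  Crossing neighbours of u and b along u′ … b or along
    -- v x … u would reroute to a path from u′ to v, so d(u) + d(b) ≤ |H|.
    module Ore {u u′ b : Fin n} {J K : List (Fin n)}
      (L : Path x u J) (u~u′ : u ~ u′) (R : Path u′ b K) (b~v : b ~ v)
      (σ : J ++ K ++ [ v ] ↭ H) (u-end : IsEnd u) (¬u′-end : ¬ IsEnd u′)
      where

      -- Take b ... u′ u ... x v.
      b-end : IsEnd b
      b-end = resp (↭-trans
        (solve 3 (λ J K v → K ⊕ J ⊕ v ⊜ J ⊕ K ⊕ v) ↭-refl J K [ v ]) σ)
        (⌊ R ⌋ ⁻¹ ⟨ ~-sym u~u′ ⟩ ⌊ L ⌋ ⁻¹ ⟨ x~v ⟩ ⌊ end v ⌋)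

      -- Otherwise u′ ... b u ... x v makes `u′` an end.
      u≁b : ¬ u ~ b
      u≁b u~b = ¬u′-end (resp (↭-trans
        (solve 3 (λ J K v → K ⊕ J ⊕ v ⊜ J ⊕ K ⊕ v) ↭-refl J K [ v ]) σ)
        (⌊ R ⌋ ⟨ ~-sym u~b ⟩ ⌊ L ⌋ ⁻¹ ⟨ x~v ⟩ ⌊ end v ⌋))

      K++vJ↭H : K ++ v ∷ J ↭ H
      K++vJ↭H = ↭-trans
        (solve 3 (λ J K v → K ⊕ v ⊕ J ⊜ J ⊕ K ⊕ v) ↭-refl J K [ v ]) σ

      count-K : count (b ~?_) K + count (u ~?_) K ≤ length K
      count-K = count₂-≤ (b ~?_) (u ~?_) K
        -- Consecutive c, c′ give the path u′ ... c b ... c′ u ... x v.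
        (λ l e b~c u~c′ → let cut {K₁} {K₂} R₁ _ R₂ eq = cutBetween R l e in
          ¬u′-end (resp (↭-trans
            (↭-trans
              (solve 4 (λ J K₁ K₂ v → K₁ ⊕ K₂ ⊕ J ⊕ v ⊜ J ⊕ (K₁ ⊕ K₂) ⊕ v) ↭-refl J K₁ K₂ [ v ])
              (++⁺ˡ J (++⁺ʳ [ v ] (↭-sym (↭-reflexive eq)))))
            σ)
          (⌊ R₁ ⌋ ⟨ ~-sym b~c ⟩ ⌊ R₂ ⌋ ⁻¹ ⟨ ~-sym u~c′ ⟩ ⌊ L ⌋ ⁻¹ ⟨ x~v ⟩ ⌊ end v ⌋)))
        (λ l e → ~-irrefl (path-last R l e))

      count-vJ : count (u ~?_) (v ∷ J) + count (b ~?_) (v ∷ J) ≤ suc (length J)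
      count-vJ = count₂-≤ (u ~?_) (b ~?_) (v ∷ J)
        -- Consecutive c, c′ give the path u′ ... b c′ ... u c ... v.
        (λ l e u~c b~c′ → let cut {J₁} {J₂} L₁ _ L₂ eq = cutBetween vL l e in
          ¬u′-end (resp (↭-trans
            (solve 3 (λ K J₁ J₂ → K ⊕ J₂ ⊕ J₁ ⊜ K ⊕ J₁ ⊕ J₂) ↭-refl K J₁ J₂)
            (↭-trans (++⁺ˡ K (↭-sym (↭-reflexive eq))) K++vJ↭H))
          (⌊ R ⌋ ⟨ b~c′ ⟩ ⌊ L₂ ⌋ ⟨ u~c ⟩ ⌊ L₁ ⌋ ⁻¹)))
        (λ l e → ~-irrefl (path-last vL l e))
        where
        vL : Path v u (v ∷ J)
        vL = ~-sym x~v ∷ L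

      degree≤ : ∀ {c} → IsEnd c → degree G c ≤ count (c ~?_) K + count (c ~?_) (v ∷ J)
      degree≤ {c} c-end = ≤-trans
        (degree≤count λ c~d → ∈-resp-↭ (↭-sym K++vJ↭H) (end-neighbour∈H c-end c~d))
        (≤-reflexive (count-++ (c ~?_) K (v ∷ J)))

      degree-sum : degree G u + degree G b ≤ length H
      degree-sum = begin
        degree G u + degree G b
          ≤⟨ +-mono-≤ (degree≤ u-end) (degree≤ b-end) ⟩
        (u₁ + u₂) + (b₁ + b₂)
          ≡⟨ solve′ 4 (λ u₁ u₂ b₁ b₂ →
               (u₁ :+ u₂) :+ (b₁ :+ b₂) := (b₁ :+ u₁) :+ (u₂ :+ b₂)) refl u₁ u₂ b₁ b₂ ⟩
        (b₁ + u₁) + (u₂ + b₂)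
          ≤⟨ +-mono-≤ count-K count-vJ ⟩
        length K + suc (length J)
          ≡⟨ trans (sym (length-++ K)) (↭-length K++vJ↭H) ⟩
        length H ∎
        where
        open ≤-Reasoning
        open +-*-Solver using (_:+_; _:=_) renaming (solve to solve′)
        u₁ = count (u ~?_) K ; u₂ = count (u ~?_) (v ∷ J)
        b₁ = count (b ~?_) K ; b₂ = count (b ~?_) (v ∷ J)

      -- The independent triple is `u`, `b`, `y`: the ends `u` and `b` have no neighbour in `B`,
      -- where `y` lies.
      impossible : ⊥
      impossible = m+n≮n 0 _ (begin-strict
        suc p                                  <⟨ ≤-reflexive (+-comm 2 p) ⟩
        p + 2                                  ≤⟨ σ₃-bound u≢b (≢y u∈H) (≢y b∈H)
                                                   u≁b (end≁B u-end y∈B) (end≁B b-end y∈B) ⟩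
        degree G u + degree G b + degree G y   ≤⟨ +-mono-≤ degree-sum degree-y ⟩
        length H + suc (length B)              ≡⟨ +-suc (length H) (length B) ⟩
        suc (length H + length B)              ≡⟨ cong suc (trans (sym (length-++ H)) (proj₂ full)) ⟩
        suc p                                  ∎)
        where
        open ≤-Reasoning
        y∈B : y ∈ B
        y∈B = last∈ Q
        ≢y : ∀ {c} → c ∈ H → c ≢ y
        ≢y c∈H refl = H∌B c∈H y∈B
        u∈H : u ∈ H
        u∈H = ∈-resp-↭ σ (∈-++⁺ˡ (last∈ L))
        b∈H : b ∈ H
        b∈H = ∈-resp-↭ σ (∈-++⁺ʳ J (∈-++⁺ˡ (last∈ R)))
        u≢b : u ≢ b
        u≢b = Unique⇒≢ J
          (proj₁ (full-resp {ys = J ++ ((K ++ [ v ]) ++ B)} (↭-trans (++⁺ʳ B (↭-sym σ)) (↭-reflexive (++-assoc J (K ++ [ v ]) B))) full))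
          (last∈ L) (∈-++⁺ˡ (∈-++⁺ˡ (last∈ R)))

    -- Being an end passes from each vertex to its successor by `Ore.impossible`. The double
    -- negation replaces a case distinction on `IsEnd`.
    ends-from : Path↭ x u xs → u ~ u′ → Path u′ v ys → xs ++ ys ↭ H → ¬ ¬ IsEnd u →
                z ∈ ys → z ≢ v → ¬ ¬ IsEnd z
    ends-from L e (end _) σ _ (here refl) z≢v _ = z≢v refl
    ends-from {xs = xs} L@(_ , L′ , τ) e R@(_∷_ {u = u′} {xs = zs} f R′) σ ¬¬u-end z∈ z≢v = go z∈
      where
      ¬¬u′-end : ¬ ¬ IsEnd u′
      ¬¬u′-end ¬u′-end with _ , K , R″ , g , eq ← unsnoc f R′ = ¬¬u-end λ u-end →
        Ore.impossible L′ e R″ g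
          (↭-trans (++⁺ τ (↭-sym (↭-reflexive eq))) σ) u-end ¬u′-end
      go : _ ∈ u′ ∷ zs → ¬ ¬ IsEnd _
      go (here refl) = ¬¬u′-end
      go (there z∈)  = ends-from (L ⟨ e ⟩ ⌊ end u′ ⌋) f R′
        (↭-trans (↭-reflexive (++-assoc xs [ u′ ] zs)) σ) ¬¬u′-end z∈ z≢v

    -- The propagation starts at `x`, an end by `P` itself.
    all-ends : u ∈ H → u ≢ v → ¬ ¬ IsEnd u
    all-ends {u} = go P ↭-refl
      where
      go : Path x v xs → xs ↭ H → u ∈ xs → u ≢ v → ¬ ¬ IsEnd u
      go (end _) _ _            _   = contradiction x~v (~-irrefl refl)
      go (e ∷ R) σ (here refl)  _   = λ ¬x-end → ¬x-end (resp σ ⌊ e ∷ R ⌋)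
      go (e ∷ R) σ (there u∈xs) u≢v =
        ends-from ⌊ end _ ⌋ e R σ (λ ¬x-end → ¬x-end (resp σ ⌊ e ∷ R ⌋)) u∈xs u≢v

    stays-in-H : u ∈ H → Star (AdjacentOutside G ⁅ v ⁆) u u′ → u′ ∈ H
    stays-in-H u∈H ε = u∈H
    stays-in-H u∈H (_◅_ {j = j} (u∉⁅v⁆ , _ , u~j) walk) = stays-in-H
      (decidable-stable (j ∈? H) λ j∉H → all-ends u∈H (x∉⁅y⁆⇒x≢y u∉⁅v⁆) λ u-end →
        j∉H (end-neighbour∈H u-end u~j))
      walk

    -- A walk from `x` to `w` avoiding `v` would have to leave `H`.
    impossible : ⊥
    impossible = bridge v
      (λ { refl → ~-irrefl refl x~v })
      (λ { refl → H∌B (last∈ P) (first∈ Q) })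
      λ walk → H∌B (stays-in-H (first∈ P) walk) (first∈ Q)

  module _ (bridge : ∀ v {u w} → u ≢ v → w ≢ v → ¬ ¬ Star (AdjacentOutside G ⁅ v ⁆) u w) where

    -- Induction on the length of the tail realises the choice of `v` with largest possible index.
    no-lollipop : ∀ m {H B} → length B ≤ m → Path↭ x v H → v ~ w → Path w y B → x ~ v →
                  ¬ Full (H ++ B)
    no-lollipop zero    le _ _ Q _ _ = contradiction (≤-trans (path-nonempty Q) le) λ ()
    no-lollipop (suc m) {B = B} le (_ , P , σ) v~w Q x~v full =
      LollipopStep.impossible bridge P v~w Q x~v (full-resp (++⁺ʳ B (↭-sym σ)) full)
        λ shorter → no-lollipop m (≤-pred (≤-trans shorter le))

    path-short : ∀ {vs} → IsPath G vs → length vs ≢ p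
    path-short {[]}             path _   = IsPath.nonempty path refl
    -- A single vertex is a cycle of order 1, so p is at least 3.
    path-short {v ∷ []}         _    len =
      m+n≮n 1 p (subst (λ l → 2 + l ≤ p) len (cycles-short (vertex v)))
    path-short {u ∷ v ∷ []}     _    len =
      <-irrefl len (cycles-short (vertex v))
    path-short {u ∷ v ∷ w ∷ ws} path len with IsPath.linked path
    ... | u~v ∷ v~w ∷ linked with _ , Q ← fromLinked w ws linked =
      -- The first edge of a longest path serves as a degenerate closed path, the rest as its tail.
      no-lollipop _ ≤-refl ⌊ u~v ∷ end v ⌋ v~w Q u~v (IsPath.distinct path , len)

-- Translating the hypotheses on σ₃ and connectivity

open import Data.Integer.Base using (+_)
open import Data.Maybe.Base using (map)
open import Data.Nat.Base using (_≥_)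
open import Data.Rational.Unnormalised.Base using (_/_; _≤_; *≤*)
open import Relation.Binary.Construct.Add.Supremum.NonStrict _≤_ using (_≤⁺_; [≤]-injective)
open import Relation.Nullary.Construct.Add.Supremum using (_⁺; [_])

-- Deleting `x`, `y` and `z` in turn lowers the cardinality each time.
triple-card : ∀ {n} {x y z : Fin n} → x ≢ y → x ≢ z → y ≢ z →
              3 ℕ.≤ ∣ ⁅ x ⁆ ∪ ⁅ y ⁆ ∪ ⁅ z ⁆ ∣
triple-card {x = x} {y} {z} x≢y x≢z y≢z =
  ≤-<-trans (≤-<-trans (≤-<-trans z≤n
    (x∈p⇒∣p-x∣<∣p∣ z∈)) (x∈p⇒∣p-x∣<∣p∣ y∈)) (x∈p⇒∣p-x∣<∣p∣ x∈)
  where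
  T = ⁅ x ⁆ ∪ ⁅ y ⁆ ∪ ⁅ z ⁆
  x∈ : x Subset.∈ T
  x∈ = x∈p∪q⁺ (inj₁ (x∈⁅x⁆ x))
  y∈ : y Subset.∈ T - x
  y∈ = x∈p∧x≢y⇒x∈p-y (x∈p∪q⁺ {p = ⁅ x ⁆} (inj₂ (x∈p∪q⁺ (inj₁ (x∈⁅x⁆ y))))) (λ eq → x≢y (sym eq))
  z∈ : z Subset.∈ T - x - y
  z∈ = x∈p∧x≢y⇒x∈p-y (x∈p∧x≢y⇒x∈p-y
    (x∈p∪q⁺ {p = ⁅ x ⁆} (inj₂ (x∈p∪q⁺ {p = ⁅ y ⁆} (inj₂ (x∈⁅x⁆ z))))) (λ eq → x≢z (sym eq))) (λ eq → y≢z (sym eq))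

module _ {n : ℕ} (G : Graph n) where
  open Graph G

  independent-triple : ∀ {x y z} → ¬ x ~ y → ¬ x ~ z → ¬ y ~ z →
                       IsIndependent G (⁅ x ⁆ ∪ ⁅ y ⁆ ∪ ⁅ z ⁆)
  independent-triple {x} {y} {z} x≁y x≁z y≁z u∈ v∈ u~v
    with elements u∈ | elements v∈
    where
    elements : ∀ {w} → w Subset.∈ ⁅ x ⁆ ∪ ⁅ y ⁆ ∪ ⁅ z ⁆ → w ≡ x ⊎ w ≡ y ⊎ w ≡ z
    elements w∈ with x∈p∪q⁻ ⁅ x ⁆ _ w∈
    ... | inj₁ w∈x = inj₁ (x∈⁅y⁆⇒x≡y x w∈x)
    ... | inj₂ w∈yz with x∈p∪q⁻ ⁅ y ⁆ _ w∈yz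
    ...   | inj₁ w∈y = inj₂ (inj₁ (x∈⁅y⁆⇒x≡y y w∈y))
    ...   | inj₂ w∈z = inj₂ (inj₂ (x∈⁅y⁆⇒x≡y z w∈z))
  ... | inj₁ refl        | inj₁ refl        = ~-irrefl refl u~v
  ... | inj₁ refl        | inj₂ (inj₁ refl) = x≁y u~v
  ... | inj₁ refl        | inj₂ (inj₂ refl) = x≁z u~v
  ... | inj₂ (inj₁ refl) | inj₁ refl        = x≁y (~-sym u~v)
  ... | inj₂ (inj₁ refl) | inj₂ (inj₁ refl) = ~-irrefl refl u~v
  ... | inj₂ (inj₁ refl) | inj₂ (inj₂ refl) = y≁z u~v
  ... | inj₂ (inj₂ refl) | inj₁ refl        = x≁z (~-sym u~v)
  ... | inj₂ (inj₂ refl) | inj₂ (inj₁ refl) = y≁z (~-sym u~v)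
  ... | inj₂ (inj₂ refl) | inj₂ (inj₂ refl) = ~-irrefl refl u~v

  -- For finite σ₃ the common denominator 3 cancels. For σ₃ = +∞ an independent triple would
  -- contradict α < 3.
  σ₃⇒triples≥ : ∀ {σ₃ p} → IsSigma₃ G σ₃ →
                 [ + (p + 2) / 3 ] ≤⁺ map (λ s → + s / 3) σ₃ →
                 Walks.IndependentTriples≥ G (p + 2)
  σ₃⇒triples≥ (finite {s = s} _ _ (_ , minimum)) bound x≢y x≢z y≢z x≁y x≁z y≁z
    with *≤* p+2≤s ← [≤]-injective bound =
    ≤-trans (ℤ.drop‿+≤+ (ℤ.*-cancelʳ-≤-pos _ (+ s) (+ 3) p+2≤s))
      (minimum _ (_ , _ , _ , (x≢y , x≢z , y≢z , independent-triple x≁y x≁z y≁z) , refl))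
  σ₃⇒triples≥ (infinite (_ , maximum) α<3) _ x≢y x≢z y≢z x≁y x≁z y≁z =
    contradiction (maximum _ (_ , independent-triple x≁y x≁z y≁z , refl))
      (<⇒≱ (<-≤-trans α<3 (triple-card x≢y x≢z y≢z)))

  -- In a complete graph one edge suffices. Otherwise `⁅ v ⁆` would be a separator with fewer than κ
  -- vertices. The double negation comes from `IsSeparator`, which denies a walk.
  2-connected⇒no-cut-vertex : TwoConnected G → ∀ v {u w} → u ≢ v → w ≢ v →
                              ¬ ¬ Star (AdjacentOutside G ⁅ v ⁆) u w
  2-connected⇒no-cut-vertex (_ , complete adjacent , _) v {u} {w} u≢v w≢v ¬walk
    with u Fin.≟ w
  ... | yes refl = ¬walk ε
  ... | no u≢w   = ¬walk ((x≢y⇒x∉⁅y⁆ u≢v , x≢y⇒x∉⁅y⁆ w≢v , adjacent u≢w) ◅ ε)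
  2-connected⇒no-cut-vertex (κ , notComplete _ (_ , minimum) , 2≤κ) v u≢v w≢v ¬walk =
    <⇒≱ 2≤κ (minimum 1
      (⁅ v ⁆ , (_ , _ , x≢y⇒x∉⁅y⁆ u≢v , x≢y⇒x∉⁅y⁆ w≢v , ¬walk) , ∣⁅x⁆∣≡1 v))

theorem2 : ∀ {n : ℕ} (G : Graph n) (p c : ℕ) (σ₃ : ℕ ⁺) →
    TwoConnected G →
    IsLongestPathOrder G p →
    IsLongestCycleOrder G c →
    IsSigma₃ G σ₃ →
    [ + (p + 2) / 3 ] ≤⁺ map (λ s → + s / 3) σ₃ →
    c ≥ p ∸ 1
theorem2 G p c σ₃ connected ((vs , path , len) , longest) (_ , longest-cycle) is-σ₃ bound
  -- The conclusion is decidable, which justifies arguing by contradiction.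
  with p ∸ 1 ≤? c
... | yes p-1≤c = p-1≤c
... | no  p-1≰c = contradiction len (path-short (2-connected⇒no-cut-vertex G connected) path)
  where
  -- The strict inequality excludes p = 0, where the subtraction would truncate.
  shift : ∀ p → c ℕ.< p ∸ 1 → 2 + c ℕ.≤ p
  shift (suc p) c<p = s≤s c<p

  cycles-short : ∀ {ws} → IsCycle G ws → 2 + length ws ℕ.≤ p
  cycles-short {ws} is-cycle = ≤-trans
    (s≤s (s≤s (longest-cycle _ (ws , is-cycle , refl))))
    (shift p (≰⇒> p-1≰c))
  open LongestPath G p (λ path → longest _ (_ , path , refl)) cycles-short
    (σ₃⇒triples≥ G is-σ₃ bound)
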